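{- Let $n\geq 1$ and let $\mathcal{G}_{2n}$ be the set of simple graphs of order $2n$ having a perfect matching. Then $\{f(G): G\in\mathcal{G}_{2n},\ F(G)=n-1\}=\{\lfloor n/2\rfloor,\lfloor n/2\rfloor+1,\dots,n-1\}$.
   Context: For a perfect matching $M$ of a graph $G$, a forcing set of $M$ is a subset of $M$ contained in no other perfect matching of $G$; the forcing number $f(G,M)$ is the smallest cardinality of a forcing set of $M$. The minimum (resp. maximum) forcing number $f(G)$ (resp. $F(G)$) is the minimum (resp. maximum) of $f(G,M)$ over all perfect matchings $M$ of $G$. -}

module Defs where

open import Data.Nat using (ℕ; zero; suc; _+_; _≤_; _<ᵇ_)
open import Data.Fin using (Fin; toℕ)
open import Data.Bool using (Bool; true; false; if_then_else_; _∧_)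
open import Data.List using (List; map; allFin)
open import Data.Nat.ListAction using (sum)
open import Data.Product using (Σ; _×_; _,_)
open import Relation.Binary.PropositionalEquality using (_≡_)

record Graph (m : ℕ) : Set where
  field
    adj    : Fin m → Fin m → Bool
    sym    : ∀ u v → adj u v ≡ adj v u
    irrefl : ∀ u → adj u u ≡ false
open Graph public

-- An edge set on Fin m, given as a Boolean relation (symmetric when used).
EdgeSet : ℕ → Set
EdgeSet m = Fin m → Fin m → Bool

Symmetric : ∀ {m} → EdgeSet m → Set
Symmetric E = ∀ u v → E u v ≡ E v u

_⊆E_ : ∀ {m} → EdgeSet m → EdgeSet m → Set
E ⊆E E' = ∀ u v → E u v ≡ true → E' u v ≡ true

countFin : ∀ {m} → (Fin m → Bool) → ℕ
countFin {m} p = sum (map (λ i → if p i then 1 else 0) (allFin m))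

edgeCount : ∀ {m} → EdgeSet m → ℕ
edgeCount {m} E = sum (map (λ u → countFin (λ v → (toℕ u <ᵇ toℕ v) ∧ E u v)) (allFin m))

IsPerfectMatching : ∀ {m} → Graph m → EdgeSet m → Set
IsPerfectMatching {m} G M =
  Symmetric M × (M ⊆E adj G) ×
  (∀ u → Σ (Fin m) λ v → (M u v ≡ true) × (∀ w → M u w ≡ true → w ≡ v))

HasPerfectMatching : ∀ {m} → Graph m → Set
HasPerfectMatching {m} G = Σ (EdgeSet m) λ M → IsPerfectMatching G M

IsForcingSet : ∀ {m} → Graph m → EdgeSet m → EdgeSet m → Set
IsForcingSet G M S =
  Symmetric S × (S ⊆E M) ×
  (∀ M' → IsPerfectMatching G M' → S ⊆E M' → ∀ u v → M' u v ≡ M u v)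

ForcingNumberIs : ∀ {m} → Graph m → EdgeSet m → ℕ → Set
ForcingNumberIs {m} G M k =
  (Σ (EdgeSet m) λ S → IsForcingSet G M S × edgeCount S ≡ k) ×
  (∀ S → IsForcingSet G M S → k ≤ edgeCount S)

MinForcingNumberIs : ∀ {m} → Graph m → ℕ → Set
MinForcingNumberIs {m} G k =
  (Σ (EdgeSet m) λ M → IsPerfectMatching G M × ForcingNumberIs G M k) ×
  (∀ M j → IsPerfectMatching G M → ForcingNumberIs G M j → k ≤ j)

MaxForcingNumberIs : ∀ {m} → Graph m → ℕ → Set
MaxForcingNumberIs {m} G k =
  (Σ (EdgeSet m) λ M → IsPerfectMatching G M × ForcingNumberIs G M k) ×
  (∀ M j → IsPerfectMatching G M → ForcingNumberIs G M j → j ≤ k)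

{-# OPTIONS --safe #-}
module Submission where

-- If f(G, M₀) = n − 1 then no two edges can be dropped from M₀, so every vertex is adjacent
-- to an end of each M₀-edge. Let S force M with 2|S| ≤ n − 2. Then two M₀-edges ab and cd
-- avoid S, the M-mates of a and b are adjacent to c or d, and those of c and d to a or b.
-- Following these choices from vertex to vertex closes up after two or four steps into an
-- M-alternating cycle avoiding S, a contradiction; hence f(G) ≥ ⌊n/2⌋.
-- Conversely, join K_n completely to a graph on n vertices whose only edges are t disjoint
-- ones. A matching all of whose edges meet K_n has forcing number n − 1. In general the edges
-- outside a forcing set include at most one meeting K_n and at most t others, and both bounds
-- are attained, so that f(G) = n − 1 − t.

open import Defs renaming (sym to adj-sym; irrefl to adj-irrefl)
open import Data.Bool using (Bool; true; false; if_then_else_; _∧_; _∨_; not)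
import Data.Bool.Properties as Bool
open import Data.Empty using (⊥; ⊥-elim)
open import Data.Fin using (Fin; zero; suc; toℕ)
open import Data.Fin.Permutation using (Permutation′; _⟨$⟩ʳ_; _⟨$⟩ˡ_; inverseʳ; inverseˡ; transpose; _∘ₚ_)
import Data.Fin.Permutation.Components as PC
open import Data.Fin.Properties using (_≟_; toℕ-injective; injective⇒≤; ¬∀⟶∃¬; 2↔Bool; *↔×; +↔⊎)
open import Data.List using (List; []; _∷_; _++_; map; length; filter; allFin; tabulate; lookup)
import Data.List.Membership.DecPropositional as DecMembership
open import Data.List.Membership.Propositional using (_∈_; _∉_)
open import Data.List.Membership.Propositional.Properties
open import Data.List.Membership.Setoid.Properties using (index-injective)
open import Data.List.Properties using (length-++; length-map; length-tabulate; map-cong; map-tabulate)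
open import Data.List.Relation.Unary.All using ([]; _∷_)
import Data.List.Relation.Unary.All as All
open import Data.List.Relation.Unary.Any using (here; there; index)
open import Data.List.Relation.Unary.Unique.Propositional using (Unique; []; _∷_)
import Data.List.Relation.Unary.Unique.Propositional.Properties as Unique
open import Data.Nat using (ℕ; zero; suc; _+_; _*_; _≤_; _<_; _∸_; ⌊_/2⌋; ⌈_/2⌉; z≤n; s≤s)
open import Data.Nat.ListAction using (sum)
import Data.Nat.Properties as ℕ
open import Data.Nat.Properties using (+-0-commutativeMonoid; +-identityʳ; ≤-antisym; <-cmp; _<?_)
open import Data.Nat.Solver using (module +-*-Solver)
open import Data.Product using (Σ; ∃; _×_; _,_; proj₁; proj₂)
open import Data.Product.Function.NonDependent.Propositional using (_×-↔_)
open import Data.Sum using (_⊎_; inj₁; inj₂)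
open import Data.Sum.Function.Propositional using (_⊎-↔_)
open import Function using (_∘_; id)
open import Function.Bundles using (Inverse; _↔_; _⇔_; mk⇔)
open import Function.Construct.Composition using (_↔-∘_)
open import Function.Construct.Identity using (↔-id)
open import Relation.Binary.Definitions using (tri<; tri≈; tri>)
open import Relation.Binary.PropositionalEquality
open import Relation.Nullary using (¬_; Dec; yes; no; does; contradiction)
open import Relation.Nullary.Decidable using (dec-true; dec-false)
open import Algebra.Properties.CommutativeMonoid.Sum +-0-commutativeMonoid
  using (sum-cong-≗; ∑-distrib-+; ∑-comm)
  renaming (sum to ∑)

private
  variable
    m : ℕ

-- Boolean equalities

false≢true : ∀ {b} → b ≡ false → b ≢ true
false≢true refl ()

≡true-ext : ∀ {b c} → (b ≡ true → c ≡ true) → (c ≡ true → b ≡ true) → b ≡ c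
≡true-ext {true}          f g = sym (f refl)
≡true-ext {false} {true}  f g = g refl
≡true-ext {false} {false} f g = refl

∧-true⁻ : ∀ {b c} → b ∧ c ≡ true → b ≡ true × c ≡ true
∧-true⁻ {true} {true} refl = refl , refl

-- Counting in Fin m

index-≡-injective : ∀ {A : Set} {x y : A} {xs} (p : x ∈ xs) (q : y ∈ xs) → index p ≡ index q → x ≡ y
index-≡-injective {A} = index-injective (setoid A)

Unique⇒lookup-injective : ∀ {A : Set} {xs : List A} → Unique xs →
  ∀ {i j} → lookup xs i ≡ lookup xs j → i ≡ j
Unique⇒lookup-injective (x∉ ∷ u) {zero}  {zero}  eq = refl
Unique⇒lookup-injective (x∉ ∷ u) {zero}  {suc j} eq = contradiction eq (All.lookup x∉ (∈-lookup j))
Unique⇒lookup-injective (x∉ ∷ u) {suc i} {zero}  eq = contradiction (sym eq) (All.lookup x∉ (∈-lookup i))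
Unique⇒lookup-injective (x∉ ∷ u) {suc i} {suc j} eq = cong suc (Unique⇒lookup-injective u eq)

-- Pigeonhole: sending a position in `xs` to a position of the same element in `ys` is injective.
Unique-⊆⇒length≤ : ∀ {A : Set} {xs ys : List A} → Unique xs →
  (∀ {x} → x ∈ xs → x ∈ ys) → length xs ≤ length ys
Unique-⊆⇒length≤ {xs = xs} u sub =
  injective⇒≤ {f = λ i → index (sub (∈-lookup {xs = xs} i))}
    (λ eq → Unique⇒lookup-injective u (index-≡-injective (sub (∈-lookup _)) (sub (∈-lookup _)) eq))

length-allFin : ∀ m → length (allFin m) ≡ m
length-allFin m = length-tabulate id

_∈?_ : (x : Fin m) (xs : List (Fin m)) → Dec (x ∈ xs)
_∈?_ = DecMembership._∈?_ _≟_

-- Both lower bounds obtain their uncovered vertices in this way.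
∃-∉ : (xs : List (Fin m)) → length xs < m → ∃ λ x → x ∉ xs
∃-∉ {m} xs len<m = ¬∀⟶∃¬ m (_∈ xs) (_∈? xs) λ all∈ →
  ℕ.<⇒≱ len<m (subst (_≤ length xs) (length-allFin m)
    (Unique-⊆⇒length≤ (Unique.allFin⁺ m) (λ {x} _ → all∈ x)))

outside : List (Fin m) → Fin m → Bool
outside xs x = not (does (x ∈? xs))

outside⁺ : ∀ {xs} {x : Fin m} → x ∈ xs → outside xs x ≡ false
outside⁺ x∈ = cong not (dec-true (_ ∈? _) x∈)

outside⁻ : ∀ {xs} {x : Fin m} → outside xs x ≡ false → x ∈ xs
outside⁻ {xs = xs} {x} eq with x ∈? xs
... | yes x∈ = x∈

indicator : Bool → ℕ
indicator b = if b then 1 else 0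

support : (Fin m → Bool) → List (Fin m)
support p = filter (λ x → p x Bool.≟ true) (allFin _)

∈-support⁺ : ∀ (p : Fin m → Bool) {x} → p x ≡ true → x ∈ support p
∈-support⁺ p px = ∈-filter⁺ (λ x → p x Bool.≟ true) (∈-allFin _) px

∈-support⁻ : ∀ (p : Fin m → Bool) {x} → x ∈ support p → p x ≡ true
∈-support⁻ p x∈ = proj₂ (∈-filter⁻ (λ x → p x Bool.≟ true) {xs = allFin _} x∈)

Unique-support : (p : Fin m → Bool) → Unique (support p)
Unique-support p = Unique.filter⁺ (λ x → p x Bool.≟ true) (Unique.allFin⁺ _)

countFin≡length : (p : Fin m → Bool) → countFin p ≡ length (support p)
countFin≡length {m} p = go (allFin m)
  where
  go : ∀ xs → sum (map (λ i → if p i then 1 else 0) xs) ≡ length (filter (λ x → p x Bool.≟ true) xs)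
  go []       = refl
  go (x ∷ xs) with p x
  ... | true  = cong suc (go xs)
  ... | false = go xs

countFin≤length : (p : Fin m → Bool) {ys : List (Fin m)} →
  (∀ x → p x ≡ true → x ∈ ys) → countFin p ≤ length ys
countFin≤length p sub = subst (_≤ _) (sym (countFin≡length p))
  (Unique-⊆⇒length≤ (Unique-support p) (λ x∈ → sub _ (∈-support⁻ p x∈)))

-- `support p` and `xs` are disjoint and free of repetitions, so their concatenation fits into
-- `allFin m`.
countFin+length≤ : (p : Fin m → Bool) {xs : List (Fin m)} → Unique xs →
  (∀ {x} → x ∈ xs → p x ≡ false) → countFin p + length xs ≤ m
countFin+length≤ {m} p {xs} u out =
  subst₂ _≤_
    (trans (length-++ (support p)) (cong (_+ length xs) (sym (countFin≡length p))))
    (length-allFin m)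
    (Unique-⊆⇒length≤ {xs = support p ++ xs}
      (Unique.++⁺ (Unique-support p) u λ (a , b) → false≢true (out b) (∈-support⁻ p a))
      (λ {x} _ → ∈-allFin x))

sum-map-allFin : (f : Fin m → ℕ) → sum (map f (allFin m)) ≡ ∑ f
sum-map-allFin f = trans (cong sum (map-tabulate id f)) (go f)
  where
  go : ∀ {m} (f : Fin m → ℕ) → sum (tabulate f) ≡ ∑ f
  go {zero}  f = refl
  go {suc m} f = cong (f zero +_) (go (f ∘ suc))

countFin-singleton : (p : Fin m → Bool) (w : Fin m) →
  (∀ v → p v ≡ true → v ≡ w) → countFin p ≡ indicator (p w)
countFin-singleton p w only with p w in pw
... | true  = ≤-antisym (countFin≤length p {w ∷ []} λ v pv → here (only v pv))
                (subst (1 ≤_) (sym (countFin≡length p))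
                  (Unique-⊆⇒length≤ {xs = w ∷ []} ([] ∷ []) λ { (here refl) → ∈-support⁺ p pw }))
... | false = ≤-antisym (countFin≤length p {[]} λ v pv →
                ⊥-elim (false≢true pw (subst (λ z → p z ≡ true) (only v pv) pv))) z≤n

-- Off the diagonal exactly one of `up u v` and `up v u` carries the value `S u v`, and exchanging
-- the order of summation shows that both halves count the edges once.
handshake : (S : EdgeSet m) → Symmetric S → (∀ u → S u u ≡ false) →
  sum (map (λ u → countFin (S u)) (allFin m)) ≡ 2 * edgeCount S
handshake {m} S S-sym S-irr = begin
  sum (map (λ u → countFin (S u)) (allFin m))
    ≡⟨ double S ⟩
  ∑ (λ u → ∑ (λ v → indicator (S u v)))
    ≡⟨ sum-cong-≗ (λ u → trans (sum-cong-≗ (split u))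
         (∑-distrib-+ (λ v → indicator (up u v)) (λ v → indicator (up v u)))) ⟩
  ∑ (λ u → ∑ (λ v → indicator (up u v)) + ∑ (λ v → indicator (up v u)))
    ≡⟨ ∑-distrib-+ (λ u → ∑ (λ v → indicator (up u v))) (λ u → ∑ (λ v → indicator (up v u))) ⟩
  ∑ (λ u → ∑ (λ v → indicator (up u v))) + ∑ (λ u → ∑ (λ v → indicator (up v u)))
    ≡⟨ cong₂ _+_ (sym (double up)) (trans (∑-comm (λ u v → indicator (up v u))) (sym (double up))) ⟩
  edgeCount S + edgeCount S
    ≡⟨ cong (edgeCount S +_) (sym (+-identityʳ _)) ⟩
  2 * edgeCount S ∎
  where
  open ≡-Reasoning
  -- `does (toℕ u <? toℕ v)` reduces to the test `toℕ u <ᵇ toℕ v` of `edgeCount`, and in this form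
  -- `dec-true` and `dec-false` can evaluate it.
  up : EdgeSet m
  up u v = does (toℕ u <? toℕ v) ∧ S u v
  double : (E : EdgeSet m) → sum (map (λ u → countFin (E u)) (allFin m)) ≡ ∑ (λ u → ∑ (λ v → indicator (E u v)))
  double E = trans (sum-map-allFin (λ u → countFin (E u))) (sum-cong-≗ λ u → sum-map-allFin (λ v → indicator (E u v)))
  split : ∀ u v → indicator (S u v) ≡ indicator (up u v) + indicator (up v u)
  split u v with <-cmp (toℕ u) (toℕ v)
  ... | tri< u<v _ v≮u rewrite dec-true (toℕ u <? toℕ v) u<v | dec-false (toℕ v <? toℕ u) v≮u = sym (+-identityʳ _)
  ... | tri> u≮v _ v<u rewrite dec-true (toℕ v <? toℕ u) v<u | dec-false (toℕ u <? toℕ v) u≮v = cong indicator (S-sym u v)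
  ... | tri≈ u≮v eq v≮u rewrite dec-false (toℕ v <? toℕ u) v≮u | dec-false (toℕ u <? toℕ v) u≮v
    with refl ← toℕ-injective eq rewrite S-irr u = refl

-- Transpositions

transpose-fst : (i j : Fin m) → PC.transpose i j i ≡ j
transpose-fst i j rewrite dec-true (i ≟ i) refl = refl

transpose-snd : (i j : Fin m) → PC.transpose i j j ≡ i
transpose-snd i j with j ≟ i
... | yes j≡i = j≡i
... | no  _ rewrite dec-true (j ≟ j) refl = refl

transpose-other : (i j : Fin m) {k : Fin m} → k ≢ i → k ≢ j → PC.transpose i j k ≡ k
transpose-other i j {k} k≢i k≢j rewrite dec-false (k ≟ i) k≢i | dec-false (k ≟ j) k≢j = refl

-- Perfect matchings and forcing sets

Adj : Graph m → Fin m → Fin m → Set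
Adj G u v = adj G u v ≡ true

Adj-sym : (G : Graph m) → ∀ {u v} → Adj G u v → Adj G v u
Adj-sym G {u} {v} uv = trans (adj-sym G v u) uv

Adj⇒≢ : (G : Graph m) → ∀ {u v} → Adj G u v → u ≢ v
Adj⇒≢ G {u} uv refl = false≢true (adj-irrefl G u) uv

module Matching {m} (G : Graph m) (M : EdgeSet m) (pm : IsPerfectMatching G M) where

  M-sym : Symmetric M
  M-sym = proj₁ pm

  mate : Fin m → Fin m
  mate u = proj₁ (proj₂ (proj₂ pm) u)

  M-mate : ∀ u → M u (mate u) ≡ true
  M-mate u = proj₁ (proj₂ (proj₂ (proj₂ pm) u))

  mate-unique : ∀ {u v} → M u v ≡ true → v ≡ mate u
  mate-unique {u} {v} = proj₂ (proj₂ (proj₂ (proj₂ pm) u)) v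

  mate-involutive : ∀ u → mate (mate u) ≡ u
  mate-involutive u = sym (mate-unique (trans (M-sym (mate u) u) (M-mate u)))

  mate-injective : ∀ {u v} → mate u ≡ mate v → u ≡ v
  mate-injective {u} {v} eq = trans (sym (mate-involutive u)) (trans (cong mate eq) (mate-involutive v))

  mate-swap : ∀ {u v} → mate u ≡ v → mate v ≡ u
  mate-swap {u} refl = mate-involutive u

  Adj-mate : ∀ u → Adj G u (mate u)
  Adj-mate u = proj₁ (proj₂ pm) u (mate u) (M-mate u)

  mate-≢ : ∀ u → mate u ≢ u
  mate-≢ u = Adj⇒≢ G (Adj-sym G (Adj-mate u))

  -- For `S ⊆E M` the only possible S-edge at u leads to its mate, so this tests whether u is an end
  -- of an S-edge.
  Covered : EdgeSet m → Fin m → Bool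
  Covered S u = S u (mate u)

  2*edgeCount : ∀ {S} → Symmetric S → S ⊆E M → 2 * edgeCount S ≡ countFin (Covered S)
  2*edgeCount {S} S-sym S⊆M = begin
    2 * edgeCount S
      ≡⟨ handshake S S-sym S-irr ⟨
    sum (map (λ u → countFin (S u)) (allFin m))
      ≡⟨ cong sum (map-cong (λ u → countFin-singleton (S u) (mate u) λ v Suv → mate-unique (S⊆M u v Suv)) (allFin m)) ⟩
    countFin (Covered S) ∎
    where
    open ≡-Reasoning
    S-irr : ∀ u → S u u ≡ false
    S-irr u with S u u in eq
    ... | true  = contradiction (sym (mate-unique (S⊆M u u eq))) (mate-≢ u)
    ... | false = refl

  -- The conjugate of M by π is again a perfect matching containing S, so it is M.
  rigid : ∀ {S} → IsForcingSet G M S → (π : Permutation′ m) →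
    (∀ u → π ⟨$⟩ʳ u ≡ u ⊎ (Covered S u ≡ false × Adj G (π ⟨$⟩ʳ u) (π ⟨$⟩ʳ mate u))) →
    ∀ u → mate (π ⟨$⟩ʳ u) ≡ π ⟨$⟩ʳ mate u
  rigid {S} (S-sym , S⊆M , forced) π ok u = sym (mate-unique
    (trans (sym (forced M′ pm′ S⊆M′ (σ u) (σ (mate u))))
      (trans (cong₂ M (inverseˡ π) (inverseˡ π)) (M-mate u))))
    where
    σ τ : Fin m → Fin m
    σ = π ⟨$⟩ʳ_
    τ = π ⟨$⟩ˡ_

    Adj-σ : ∀ u → Adj G (σ u) (σ (mate u))
    Adj-σ u with ok u | ok (mate u)
    ... | inj₂ (_ , e) | _            = e
    ... | inj₁ _       | inj₂ (_ , e) = Adj-sym G (subst (λ z → Adj G (σ (mate u)) (σ z)) (mate-involutive u) e)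
    ... | inj₁ eq      | inj₁ eq′     = subst₂ (Adj G) (sym eq) (sym eq′) (Adj-mate u)

    -- An end of an S-edge is covered, so `ok` leaves only the case in which π fixes it.
    fixed : ∀ {u v} → S u v ≡ true → τ u ≡ u
    fixed {u} {v} Suv with ok u
    ... | inj₁ eq      = trans (cong τ (sym eq)) (inverseˡ π)
    ... | inj₂ (f , _) = ⊥-elim (false≢true f (subst (λ z → S u z ≡ true) (mate-unique (S⊆M u v Suv)) Suv))

    M′ : EdgeSet m
    M′ u v = M (τ u) (τ v)

    pm′ : IsPerfectMatching G M′
    pm′ = (λ u v → M-sym (τ u) (τ v))
        , (λ u v Muv → subst₂ (Adj G) (inverseʳ π)
             (trans (cong σ (sym (mate-unique Muv))) (inverseʳ π)) (Adj-σ (τ u)))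
        , λ u → σ (mate (τ u))
              , trans (cong (M (τ u)) (inverseˡ π)) (M-mate (τ u))
              , λ w Mw → trans (sym (inverseʳ π)) (cong σ (mate-unique Mw))

    S⊆M′ : S ⊆E M′
    S⊆M′ u v Suv = trans (cong₂ M (fixed Suv) (fixed (trans (S-sym v u) Suv))) (S⊆M u v Suv)

  -- Alternating cycles avoiding a forcing set

  module _ {S : EdgeSet m} (forcing : IsForcingSet G M S) where

    -- Transposing x and y trades their M-edges for the two given edges. These edges also show that
    -- x and y are not mates, so both mates stay fixed and rigidity yields `mate y ≡ mate x`.
    no-alternating-4-cycle : ∀ {x y} → x ≢ y → Covered S x ≡ false → Covered S y ≡ false →
      Adj G (mate x) y → Adj G (mate y) x → ⊥
    no-alternating-4-cycle {x} {y} x≢y x-free y-free x′y y′x =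
      x≢y (mate-injective (sym (subst₂ (λ a b → mate a ≡ b) (transpose-fst x y) fix-x′ (rigid forcing (transpose x y) (λ u → ok u (u ≟ x) (u ≟ y)) x))))
      where
      fix-x′ : PC.transpose x y (mate x) ≡ mate x
      fix-x′ = transpose-other x y (mate-≢ x) (Adj⇒≢ G x′y)
      fix-y′ : PC.transpose x y (mate y) ≡ mate y
      fix-y′ = transpose-other x y (Adj⇒≢ G y′x) (mate-≢ y)
      ok : ∀ u → Dec (u ≡ x) → Dec (u ≡ y) →
        PC.transpose x y u ≡ u ⊎ (Covered S u ≡ false × Adj G (PC.transpose x y u) (PC.transpose x y (mate u)))
      ok u (yes refl) _          = inj₂ (x-free , subst₂ (Adj G) (sym (transpose-fst x y)) (sym fix-x′) (Adj-sym G x′y))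
      ok u (no _)     (yes refl) = inj₂ (y-free , subst₂ (Adj G) (sym (transpose-snd x y)) (sym fix-y′) (Adj-sym G y′x))
      ok u (no u≢x)   (no u≢y)   = inj₁ (transpose-other x y u≢x u≢y)

    -- The permutation a → c → b → d → a replaces the four matching edges at a, b, c, d
    -- along an alternating 8-cycle, which degenerates to a 6-cycle if a and b, or c and d,
    -- are mates of each other.
    no-alternating-8-cycle : ∀ {a b c d} →
      a ≢ b → a ≢ c → a ≢ d → b ≢ c → b ≢ d → c ≢ d →
      Covered S a ≡ false → Covered S b ≡ false → Covered S c ≡ false → Covered S d ≡ false →
      Adj G a b → Adj G c d →
      Adj G (mate a) c → Adj G (mate c) b → Adj G (mate b) d → Adj G (mate d) a → ⊥
    no-alternating-8-cycle {a} {b} {c} {d} a≢b a≢c a≢d b≢c b≢d c≢d a-free b-free c-free d-free ab cd a′c c′b b′d d′a =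
      absurd (mate a ≟ b) (mate c ≟ d)
      where
      π : Permutation′ m
      -- `_∘ₚ_` applies its left factor first.
      π = transpose a c ∘ₚ transpose a b ∘ₚ transpose a d

      σ : Fin m → Fin m
      σ = π ⟨$⟩ʳ_

      σ-steps : ∀ u {v w z} → PC.transpose a c u ≡ v → PC.transpose a b v ≡ w → PC.transpose a d w ≡ z → σ u ≡ z
      σ-steps u refl refl refl = refl

      σa : σ a ≡ c
      σa = σ-steps a (transpose-fst a c) (transpose-other a b (a≢c ∘ sym) (b≢c ∘ sym)) (transpose-other a d (a≢c ∘ sym) c≢d)
      σb : σ b ≡ d
      σb = σ-steps b (transpose-other a c (a≢b ∘ sym) b≢c) (transpose-snd a b) (transpose-fst a d)
      σc : σ c ≡ b
      σc = σ-steps c (transpose-snd a c) (transpose-fst a b) (transpose-other a d (a≢b ∘ sym) b≢d)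
      σd : σ d ≡ a
      σd = σ-steps d (transpose-other a c (a≢d ∘ sym) (c≢d ∘ sym)) (transpose-other a b (a≢d ∘ sym) (b≢d ∘ sym)) (transpose-snd a d)
      σ-other : ∀ {u} → u ≢ a → u ≢ b → u ≢ c → u ≢ d → σ u ≡ u
      σ-other {u} u≢a u≢b u≢c u≢d = σ-steps u (transpose-other a c u≢a u≢c) (transpose-other a b u≢a u≢b) (transpose-other a d u≢a u≢d)

      -- The M-edge at x goes to y z if o is the mate of x; otherwise π fixes `mate x` and the image
      -- joins y to `mate x`.
      step : ∀ {x y z o} → σ x ≡ y → σ o ≡ z → Adj G y z → Adj G (mate x) y → Adj G (mate z) x →
        (mate x ≢ x → mate x ≢ y → mate x ≢ z → mate x ≢ o → σ (mate x) ≡ mate x) →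
        Adj G (σ x) (σ (mate x))
      step {x} {y} {z} {o} σx σo yz x′y z′x other with mate x ≟ o
      ... | yes x′≡o = subst₂ (Adj G) (sym σx) (trans (sym σo) (cong σ (sym x′≡o))) yz
      ... | no  x′≢o = subst₂ (Adj G) (sym σx)
              (sym (other (mate-≢ x) (Adj⇒≢ G x′y) (λ x′≡z → Adj⇒≢ G z′x (mate-swap x′≡z)) x′≢o))
              (Adj-sym G x′y)

      ok : ∀ u → Dec (u ≡ a) → Dec (u ≡ b) → Dec (u ≡ c) → Dec (u ≡ d) →
        σ u ≡ u ⊎ (Covered S u ≡ false × Adj G (σ u) (σ (mate u)))
      ok u (yes refl) _ _ _ = inj₂ (a-free , step σa σb cd a′c d′a λ ≢a ≢c ≢d ≢b → σ-other ≢a ≢b ≢c ≢d)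
      ok u (no _) (yes refl) _ _ = inj₂ (b-free , step σb σa (Adj-sym G cd) b′d c′b λ ≢b ≢d ≢c ≢a → σ-other ≢a ≢b ≢c ≢d)
      ok u (no _) (no _) (yes refl) _ = inj₂ (c-free , step σc σd (Adj-sym G ab) c′b a′c λ ≢c ≢b ≢a ≢d → σ-other ≢a ≢b ≢c ≢d)
      ok u (no _) (no _) (no _) (yes refl) = inj₂ (d-free , step σd σc ab d′a b′d λ ≢d ≢a ≢b ≢c → σ-other ≢a ≢b ≢c ≢d)
      ok u (no u≢a) (no u≢b) (no u≢c) (no u≢d) = inj₁ (σ-other u≢a u≢b u≢c u≢d)

      c′≡σa′ : mate c ≡ σ (mate a)
      c′≡σa′ = subst (λ z → mate z ≡ σ (mate a)) σa (rigid forcing π (λ u → ok u (u ≟ a) (u ≟ b) (u ≟ c) (u ≟ d)) a)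

      absurd : Dec (mate a ≡ b) → Dec (mate c ≡ d) → ⊥
      -- If ab and cd are both M-edges, then π carries M to itself and rigidity gives nothing, but
      -- a, b, c, d form an alternating 4-cycle.
      absurd (yes a′≡b) (yes c′≡d) = no-alternating-4-cycle a≢c a-free c-free a′c
        (subst (λ z → Adj G z a) (sym c′≡d) (Adj-sym G (subst (λ z → Adj G z d) (mate-swap a′≡b) b′d)))
      absurd (yes a′≡b) (no c′≢d) = c′≢d (trans c′≡σa′ (trans (cong σ a′≡b) σb))
      absurd (no a′≢b)  _ = a≢c (mate-injective (sym (trans c′≡σa′
        (σ-other (mate-≢ a) a′≢b (Adj⇒≢ G a′c) (λ a′≡d → Adj⇒≢ G d′a (mate-swap a′≡d))))))

    -- The mate of each of the four vertices picks a neighbour in the other pair. Two picks pointing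
    -- at each other close a 4-cycle; without such picks, they run through all four vertices in one
    -- of two cyclic orders.
    no-dominating-pair : ∀ {a b c d} →
      a ≢ b → a ≢ c → a ≢ d → b ≢ c → b ≢ d → c ≢ d →
      Covered S a ≡ false → Covered S b ≡ false → Covered S c ≡ false → Covered S d ≡ false →
      (∀ w → Adj G w a ⊎ Adj G w b) → (∀ w → Adj G w c ⊎ Adj G w d) → Adj G a b → Adj G c d → ⊥
    no-dominating-pair {a} {b} {c} {d} a≢b a≢c a≢d b≢c b≢d c≢d fa fb fc fd ab-dom cd-dom ab cd
      with cd-dom (mate a) | cd-dom (mate b) | ab-dom (mate c) | ab-dom (mate d)
    ... | inj₁ a′c | _        | inj₁ c′a | _        = no-alternating-4-cycle a≢c fa fc a′c c′a
    ... | _        | inj₁ b′c | inj₂ c′b | _        = no-alternating-4-cycle b≢c fb fc b′c c′b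
    ... | inj₂ a′d | _        | _        | inj₁ d′a = no-alternating-4-cycle a≢d fa fd a′d d′a
    ... | _        | inj₂ b′d | _        | inj₂ d′b = no-alternating-4-cycle b≢d fb fd b′d d′b
    ... | inj₁ a′c | inj₂ b′d | inj₂ c′b | inj₁ d′a =
      no-alternating-8-cycle a≢b a≢c a≢d b≢c b≢d c≢d fa fb fc fd ab cd a′c c′b b′d d′a
    ... | inj₂ a′d | inj₁ b′c | inj₁ c′a | inj₂ d′b =
      no-alternating-8-cycle a≢b a≢d a≢c b≢d b≢c (c≢d ∘ sym) fa fb fd fc ab (Adj-sym G cd) a′d d′b b′c c′a

  -- Testing one end suffices: `p` will be invariant under `mate`, so both ends agree.
  keep : (Fin m → Bool) → EdgeSet m
  keep p u v = M u v ∧ p u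

  module _ (p : Fin m → Bool) (p-mate : ∀ u → p (mate u) ≡ p u) where

    keep-sym : Symmetric (keep p)
    keep-sym u v with M u v in uv | M v u in vu
    ... | true  | true  = sym (trans (cong p (mate-unique uv)) (p-mate u))
    ... | false | false = refl
    ... | true  | false = contradiction (trans (M-sym v u) uv) (false≢true vu)
    ... | false | true  = contradiction (trans (M-sym u v) vu) (false≢true uv)

    keep-⊆ : keep p ⊆E M
    keep-⊆ u v = proj₁ ∘ ∧-true⁻

    keep-covered : ∀ u → Covered (keep p) u ≡ p u
    keep-covered u = cong (_∧ p u) (M-mate u)

    keep-count : 2 * edgeCount (keep p) ≡ countFin p
    keep-count = trans (2*edgeCount keep-sym keep-⊆)
      (cong sum (map-cong (λ u → cong indicator (keep-covered u)) (allFin m)))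

-- Forcing sets described by what they leave out

-- A perfect matching containing the kept edges agrees with M where `p` holds and hence matches the
-- rest within itself, so agreement needs checking only there.
forcing-by-mates : (G : Graph m) (M : EdgeSet m) (pm : IsPerfectMatching G M) →
  let open Matching G M pm in
  (p : Fin m → Bool) (p-mate : ∀ u → p (mate u) ≡ p u) →
  (∀ {M′} (pm′ : IsPerfectMatching G M′) → let mate′ = Matching.mate G M′ pm′ in
    (∀ u → p (mate′ u) ≡ p u) → (∀ u → p u ≡ false → mate′ u ≡ mate u)) →
  IsForcingSet G M (keep p)
forcing-by-mates {m} G M pm p p-mate agree = keep-sym p p-mate , keep-⊆ p p-mate , forced
  where
  open Matching G M pm
  forced : ∀ M′ → IsPerfectMatching G M′ → keep p ⊆E M′ → ∀ u v → M′ u v ≡ M u v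
  forced M′ pm′ sub u v = ≡true-ext
    (λ M′uv → subst (λ z → M u z ≡ true) (sym (trans (M′.mate-unique M′uv) (same u))) (M-mate u))
    (λ Muv → subst (λ z → M′ u z ≡ true) (sym (trans (mate-unique Muv) (sym (same u)))) (M′.M-mate u))
    where
    module M′ = Matching G M′ pm′
    kept : ∀ u → p u ≡ true → M′.mate u ≡ mate u
    kept u pu = sym (M′.mate-unique (sub u (mate u) (trans (keep-covered p p-mate u) pu)))
    closed : ∀ u → p (M′.mate u) ≡ p u
    closed u = ≡true-ext
      -- If the M′-mate of u is kept, its two mates coincide, so u is also its mate in M and
      -- invariance under `mate` applies.
      (λ pu′ → trans (sym (p-mate u)) (trans (cong p (mate-swap (trans (sym (kept _ pu′)) (M′.mate-involutive u))) ) pu′))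
      (λ pu → trans (cong p (kept u pu)) (trans (p-mate u) pu))
    same : ∀ u → M′.mate u ≡ mate u
    same u with p u in pu
    ... | true  = kept u pu
    ... | false = agree pm′ closed u pu

-- The M-edges avoiding `xs` force M once every perfect matching that matches `xs` within itself
-- does so as M does. Thus a long `xs` yields a small forcing set.
forcing-outside : (G : Graph m) (M : EdgeSet m) (pm : IsPerfectMatching G M) →
  let open Matching G M pm in
  {xs : List (Fin m)} → Unique xs → (∀ {u} → u ∈ xs → mate u ∈ xs) →
  (∀ {M′} (pm′ : IsPerfectMatching G M′) → let mate′ = Matching.mate G M′ pm′ in
    (∀ {u} → u ∈ xs → mate′ u ∈ xs) → (∀ {u} → u ∈ xs → mate′ u ≡ mate u)) →
  ∃ λ S → IsForcingSet G M S × 2 * edgeCount S + length xs ≤ m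
forcing-outside {m} G M pm {xs} uniq closed agree =
  keep p , forcing-by-mates G M pm p p-mate (λ pm′ p-mate′ u pu → agree pm′
      (λ {v} v∈ → outside⁻ (trans (p-mate′ v) (outside⁺ v∈))) (outside⁻ pu))
    , subst (λ c → c + length xs ≤ m) (sym (keep-count p p-mate)) (countFin+length≤ p uniq outside⁺)
  where
  open Matching G M pm
  p : Fin m → Bool
  p = outside xs
  p-mate : ∀ u → p (mate u) ≡ p u
  p-mate u with p u in pu | p (mate u) in pu′
  ... | true  | true  = refl
  ... | false | false = refl
  ... | true  | false = contradiction pu (false≢true (outside⁺ (subst (_∈ xs) (mate-involutive u) (closed (outside⁻ pu′)))))
  ... | false | true  = contradiction pu′ (false≢true (outside⁺ (closed (outside⁻ pu))))

-- The bound n - 1 and the matchings attaining it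

2*e+2≤2*n⇒e≤n∸1 : ∀ {e n} → 2 * e + 2 ≤ 2 * n → e ≤ n ∸ 1
2*e+2≤2*n⇒e≤n∸1 {e} {n} le = ℕ.∸-monoˡ-≤ {suc e} {n} 1 (ℕ.*-cancelˡ-≤ {suc e} {n} 2 (subst (_≤ 2 * n) eq le))
  where
  eq : 2 * e + 2 ≡ 2 * suc e
  eq = trans (ℕ.+-comm (2 * e) 2) (sym (ℕ.*-suc 2 e))

-- All M-edges but one force M, since the two vertices left over can only be matched to each other.
forcing-n∸1 : ∀ {n} → 1 ≤ n → (G : Graph (2 * n)) (M : EdgeSet (2 * n)) → IsPerfectMatching G M →
  ∃ λ S → IsForcingSet G M S × edgeCount S ≤ n ∸ 1
forcing-n∸1 {n@(suc _)} _ G M pm =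
  let S , forcing , le = forcing-outside G M pm uniq closed agree
  in  S , forcing , 2*e+2≤2*n⇒e≤n∸1 {n = n} le
  where
  open Matching G M pm
  a : Fin (2 * n)
  a = zero
  uniq : Unique (a ∷ mate a ∷ [])
  uniq = ((mate-≢ a ∘ sym) ∷ []) ∷ [] ∷ []
  closed : ∀ {u} → u ∈ a ∷ mate a ∷ [] → mate u ∈ a ∷ mate a ∷ []
  closed (here refl)         = there (here refl)
  closed (there (here refl)) = here (mate-involutive a)
  agree : ∀ {M′} (pm′ : IsPerfectMatching G M′) → let mate′ = Matching.mate G M′ pm′ in
    (∀ {u} → u ∈ a ∷ mate a ∷ [] → mate′ u ∈ a ∷ mate a ∷ []) → ∀ {u} → u ∈ a ∷ mate a ∷ [] → mate′ u ≡ mate u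
  agree {M′} pm′ closed′ {u} u∈ with u∈ | closed′ u∈
  ... | here refl         | here eq         = contradiction eq (Matching.mate-≢ G M′ pm′ a)
  ... | here refl         | there (here eq) = eq
  ... | there (here refl) | here eq         = trans eq (sym (mate-involutive a))
  ... | there (here refl) | there (here eq) = contradiction eq (Matching.mate-≢ G M′ pm′ (mate a))

forcing-number≤n∸1 : ∀ {n j} → 1 ≤ n → (G : Graph (2 * n)) (M : EdgeSet (2 * n)) → IsPerfectMatching G M →
  ForcingNumberIs G M j → j ≤ n ∸ 1
forcing-number≤n∸1 {n} 1≤n G M pm (_ , least) =
  let S , forcing , le = forcing-n∸1 {n} 1≤n G M pm in ℕ.≤-trans (least S forcing) le

-- If neither a nor its mate b is adjacent to w, then any perfect matching agreeing with M
-- outside a, b, w and the mate of w must match w as M does, hence also a.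
extremal⇒dominating : ∀ {n} (G : Graph (2 * n)) (M : EdgeSet (2 * n)) (pm : IsPerfectMatching G M) →
  ForcingNumberIs G M (n ∸ 1) → ∀ a w → Adj G w a ⊎ Adj G w (Matching.mate G M pm a)
extremal⇒dominating {n} G M pm (_ , least) a w with adj G w a in wa | adj G w (Matching.mate G M pm a) in wb
... | true  | _     = inj₁ refl
... | false | true  = inj₂ refl
... | false | false = ⊥-elim (absurd (forcing-outside G M pm uniq closed agree))
  where
  open Matching G M pm
  b w′ : Fin (2 * n)
  b = mate a
  w′ = mate w
  xs : List (Fin (2 * n))
  xs = a ∷ b ∷ w ∷ w′ ∷ []
  a≢w : a ≢ w
  a≢w refl = false≢true wb (Adj-mate a)
  b≢w : b ≢ w
  b≢w refl = false≢true wa (Adj-sym G (Adj-mate a))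
  uniq : Unique xs
  uniq = ((mate-≢ a ∘ sym) ∷ a≢w ∷ (λ a≡w′ → b≢w (mate-swap (sym a≡w′))) ∷ [])
    ∷ (b≢w ∷ (a≢w ∘ mate-injective) ∷ []) ∷ ((mate-≢ w ∘ sym) ∷ []) ∷ [] ∷ []
  closed : ∀ {u} → u ∈ xs → mate u ∈ xs
  closed (here refl)                         = there (here refl)
  closed (there (here refl))                 = here (mate-involutive a)
  closed (there (there (here refl)))         = there (there (there (here refl)))
  closed (there (there (there (here refl)))) = there (there (here (mate-involutive w)))
  agree : ∀ {M′} (pm′ : IsPerfectMatching G M′) → let mate′ = Matching.mate G M′ pm′ in
    (∀ {u} → u ∈ xs → mate′ u ∈ xs) → ∀ {u} → u ∈ xs → mate′ u ≡ mate u
  agree {M′} pm′ closed′ = λ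
    { (here refl)                         → at-a
    ; (there (here refl))                 → trans (M′.mate-swap at-a) (sym (mate-involutive a))
    ; (there (there (here refl)))         → at-w
    ; (there (there (there (here refl)))) → trans (M′.mate-swap at-w) (sym (mate-involutive w)) }
    where
    module M′ = Matching G M′ pm′
    -- Within `xs` the vertex w has no neighbour but its mate. Once these two are matched, only b is
    -- left for a.
    at-w : M′.mate w ≡ mate w
    at-w with closed′ (there (there (here refl)))
    ... | here eq                         = ⊥-elim (false≢true wa (subst (Adj G w) eq (M′.Adj-mate w)))
    ... | there (here eq)                 = ⊥-elim (false≢true wb (subst (Adj G w) eq (M′.Adj-mate w)))
    ... | there (there (here eq))         = contradiction eq (M′.mate-≢ w)
    ... | there (there (there (here eq))) = eq
    at-a : M′.mate a ≡ mate a
    at-a with closed′ (here refl)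
    ... | here eq                         = contradiction eq (M′.mate-≢ a)
    ... | there (here eq)                 = eq
    ... | there (there (here eq))         = ⊥-elim (false≢true wa (subst (Adj G w) (M′.mate-swap eq) (M′.Adj-mate w)))
    ... | there (there (there (here eq))) = contradiction (M′.mate-injective (trans eq (sym at-w))) a≢w
  absurd : ∃ (λ S → IsForcingSet G M S × 2 * edgeCount S + 4 ≤ 2 * n) → ⊥
  absurd (S , forcing , le) = ℕ.<-irrefl refl (begin-strict
    -- An inequality rather than an equation, because the subtraction truncates at n = 0.
    2 * n               ≤⟨ ℕ.m≤n+m∸n (2 * n) 2 ⟩
    2 + (2 * n ∸ 2)     ≡⟨ cong (2 +_) (ℕ.*-distribˡ-∸ 2 n 1) ⟨
    2 + 2 * (n ∸ 1)     ≤⟨ ℕ.+-monoʳ-≤ 2 (ℕ.*-monoʳ-≤ 2 (least S forcing)) ⟩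
    2 + 2 * edgeCount S <⟨ ℕ.+-monoˡ-< (2 * edgeCount S) {2} {4} (s≤s (s≤s (s≤s z≤n))) ⟩
    4 + 2 * edgeCount S ≡⟨ ℕ.+-comm 4 (2 * edgeCount S) ⟩
    2 * edgeCount S + 4 ≤⟨ le ⟩
    2 * n               ∎)
    where open ℕ.≤-Reasoning

-- Lower bound: S and the M₀-mates of its end points cover at most 4 |S| vertices.
⌊n/2⌋≤forcing : ∀ {n} (G : Graph (2 * n)) (M₀ M : EdgeSet (2 * n)) →
  IsPerfectMatching G M₀ → ForcingNumberIs G M₀ (n ∸ 1) →
  IsPerfectMatching G M → ∀ S → IsForcingSet G M S → ⌊ n /2⌋ ≤ edgeCount S
⌊n/2⌋≤forcing {n} G M₀ M pm₀ extremal pm S forcing@(S-sym , S⊆M , _) = ℕ.≮⇒≥ absurd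
  where
  open Matching G M pm
  module M₀ = Matching G M₀ pm₀
  C L : List (Fin (2 * n))
  C = support (Covered S)
  -- Including the M₀-mates makes both ends of the M₀-edge at any vertex outside `L` uncovered.
  L = C ++ map M₀.mate C
  e = edgeCount S
  length-L : length L ≡ 4 * e
  length-L = begin
    length L                          ≡⟨ length-++ C ⟩
    length C + length (map M₀.mate C) ≡⟨ cong (length C +_) (length-map M₀.mate C) ⟩
    length C + length C               ≡⟨ cong (λ k → k + k) (trans (sym (countFin≡length (Covered S))) (sym (2*edgeCount S-sym S⊆M))) ⟩
    2 * e + 2 * e                     ≡⟨ ℕ.*-distribʳ-+ e 2 2 ⟨
    4 * e                             ∎
    where open ≡-Reasoning
  free : ∀ {u} → u ∉ L → Covered S u ≡ false
  free {u} u∉ with Covered S u in eq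
  ... | true  = contradiction (∈-++⁺ˡ (∈-support⁺ (Covered S) eq)) u∉
  ... | false = refl
  mate-free : ∀ {u} → u ∉ L → Covered S (M₀.mate u) ≡ false
  mate-free {u} u∉ with Covered S (M₀.mate u) in eq
  ... | true  = contradiction (∈-++⁺ʳ C (subst (_∈ map M₀.mate C) (M₀.mate-involutive u)
                  (∈-map⁺ M₀.mate (∈-support⁺ (Covered S) eq)))) u∉
  ... | false = refl
  dom = extremal⇒dominating {n} G M₀ pm₀ extremal
  no-two-edges : ∀ {a c} → a ∉ L → c ∉ a ∷ M₀.mate a ∷ L → ⊥
  no-two-edges {a} {c} a∉ c∉ = no-dominating-pair forcing {a} {M₀.mate a} {c} {M₀.mate c}
    (M₀.mate-≢ a ∘ sym) (λ a≡c → c∉ (here (sym a≡c))) (λ a≡d → c∉ (there (here (sym (M₀.mate-swap (sym a≡d))))))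
    (λ b≡c → c∉ (there (here (sym b≡c)))) (λ b≡d → c∉ (here (sym (M₀.mate-injective b≡d)))) (M₀.mate-≢ c ∘ sym)
    (free a∉) (mate-free a∉) (free (c∉ ∘ there ∘ there)) (mate-free (c∉ ∘ there ∘ there))
    (dom a) (dom c) (M₀.Adj-mate a) (M₀.Adj-mate c)
  2*⌊n/2⌋≤n : 2 * ⌊ n /2⌋ ≤ n
  2*⌊n/2⌋≤n = begin
    2 * ⌊ n /2⌋       ≡⟨ cong (⌊ n /2⌋ +_) (+-identityʳ ⌊ n /2⌋) ⟩
    ⌊ n /2⌋ + ⌊ n /2⌋ ≤⟨ ℕ.+-monoʳ-≤ ⌊ n /2⌋ (ℕ.⌊n/2⌋-mono (ℕ.n≤1+n n)) ⟩
    ⌊ n /2⌋ + ⌈ n /2⌉ ≡⟨ ℕ.⌊n/2⌋+⌈n/2⌉≡n n ⟩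
    n                 ∎
    where open ℕ.≤-Reasoning
  -- Leaves room for c beside `L` and the two ends of the first M₀-edge. In fact 4e + 4 ≤ 2n, one
  -- more than needed.
  bound : e < ⌊ n /2⌋ → 2 + length L < 2 * n
  bound e< = begin
    3 + length L      ≡⟨ cong (3 +_) length-L ⟩
    3 + 4 * e         ≤⟨ ℕ.n≤1+n _ ⟩
    4 + 4 * e         ≡⟨ ℕ.*-suc 4 e ⟨
    4 * suc e         ≤⟨ ℕ.*-monoʳ-≤ 4 e< ⟩
    4 * ⌊ n /2⌋       ≡⟨ ℕ.*-assoc 2 2 ⌊ n /2⌋ ⟩
    2 * (2 * ⌊ n /2⌋) ≤⟨ ℕ.*-monoʳ-≤ 2 2*⌊n/2⌋≤n ⟩
    2 * n             ∎
    where open ℕ.≤-Reasoning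
  absurd : e < ⌊ n /2⌋ → ⊥
  absurd e< =
    let a , a∉ = ∃-∉ L (ℕ.≤-trans (s≤s (ℕ.m≤n+m (length L) 2)) (bound e<))
        c , c∉ = ∃-∉ (a ∷ M₀.mate a ∷ L) (bound e<)
    in  no-two-edges a∉ c∉

-- The graphs attaining the other values

involution-matching : (Fin m → Fin m) → EdgeSet m
involution-matching f u v = does (f u ≟ v)

involution-isPerfectMatching : (G : Graph m) (f : Fin m → Fin m) →
  (∀ u → f (f u) ≡ u) → (∀ u → Adj G u (f u)) → IsPerfectMatching G (involution-matching f)
involution-isPerfectMatching G f f-inv f-adj =
    (λ u v → ≡true-ext (flip u v) (flip v u))
  , (λ u v uv → subst (Adj G u) (does⁻ u v uv) (f-adj u))
  , λ u → f u , dec-true (f u ≟ f u) refl , λ w uw → sym (does⁻ u w uw)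
  where
  does⁻ : ∀ u v → does (f u ≟ v) ≡ true → f u ≡ v
  does⁻ u v eq with f u ≟ v
  ... | yes fu≡v = fu≡v
  flip : ∀ u v → does (f u ≟ v) ≡ true → does (f v ≟ u) ≡ true
  flip u v eq = dec-true (f v ≟ u) (trans (cong f (sym (does⁻ u v eq))) (f-inv u))

-- The vertices in D are adjacent to everything; among the others only the pairs {x , P x}
-- are edges. Every Q-edge has an end in D.
module Construction {m} (D : Fin m → Bool) (P Q : Fin m → Fin m)
  (P-involutive : ∀ x → P (P x) ≡ x) (P-≢ : ∀ x → P x ≢ x)
  (Q-involutive : ∀ x → Q (Q x) ≡ x) (D-Q : ∀ x → D (Q x) ≡ not (D x))
  where

  Joined : Fin m → Fin m → Set
  Joined x y = D x ≡ true ⊎ D y ≡ true ⊎ P x ≡ y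

  joined? : EdgeSet m
  joined? x y = not (does (x ≟ y)) ∧ (D x ∨ D y ∨ does (P x ≟ y))

  joined?⁺ : ∀ {x y} → x ≢ y → Joined x y → joined? x y ≡ true
  joined?⁺ {x} {y} x≢y j rewrite dec-false (x ≟ y) x≢y with D x | D y | j
  ... | true  | _     | _                = refl
  ... | false | true  | _                = refl
  ... | false | false | inj₂ (inj₂ Px≡y) = dec-true (P x ≟ y) Px≡y

  joined?⁻ : ∀ x y → joined? x y ≡ true → x ≢ y × Joined x y
  joined?⁻ x y eq with x ≟ y | D x | D y | P x ≟ y
  ... | no x≢y | true  | _     | _        = x≢y , inj₁ refl
  ... | no x≢y | false | true  | _        = x≢y , inj₂ (inj₁ refl)
  ... | no x≢y | false | false | yes Px≡y = x≢y , inj₂ (inj₂ Px≡y)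

  Joined-sym : ∀ {x y} → Joined x y → Joined y x
  Joined-sym (inj₁ Dx)            = inj₂ (inj₁ Dx)
  Joined-sym (inj₂ (inj₁ Dy))     = inj₁ Dy
  Joined-sym (inj₂ (inj₂ refl))   = inj₂ (inj₂ (P-involutive _))

  joined?-flip : ∀ x y → joined? x y ≡ true → joined? y x ≡ true
  joined?-flip x y eq = let x≢y , j = joined?⁻ x y eq in joined?⁺ (x≢y ∘ sym) (Joined-sym j)

  G : Graph m
  G = record
    { adj    = joined?
    ; sym    = λ x y → ≡true-ext (joined?-flip x y) (joined?-flip y x)
    ; irrefl = λ x → cong (λ b → not b ∧ (D x ∨ D x ∨ does (P x ≟ x))) (dec-true (x ≟ x) refl)
    }

  Adj⇒P : ∀ {x y} → D x ≡ false → D y ≡ false → Adj G x y → P x ≡ y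
  Adj⇒P {x} {y} Dx Dy xy with proj₂ (joined?⁻ x y xy)
  ... | inj₁ Dx′         = contradiction Dx′ (false≢true Dx)
  ... | inj₂ (inj₁ Dy′)  = contradiction Dy′ (false≢true Dy)
  ... | inj₂ (inj₂ Px≡y) = Px≡y

  P-matching Q-matching : EdgeSet m
  P-matching = involution-matching P
  Q-matching = involution-matching Q

  P-isPerfectMatching : IsPerfectMatching G P-matching
  P-isPerfectMatching = involution-isPerfectMatching G P P-involutive
    λ x → joined?⁺ (P-≢ x ∘ sym) (inj₂ (inj₂ refl))

  Q-isPerfectMatching : IsPerfectMatching G Q-matching
  Q-isPerfectMatching = involution-isPerfectMatching G Q Q-involutive λ x → joined?⁺ (Q-≢ x) (Q-joined x)
    where
    Q-≢ : ∀ x → x ≢ Q x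
    Q-≢ x x≡Qx = Bool.not-¬ refl (trans (cong D x≡Qx) (D-Q x))
    Q-joined : ∀ x → Joined x (Q x)
    Q-joined x with D x | D-Q x
    ... | true  | _   = inj₁ refl
    ... | false | DQx = inj₂ (inj₁ DQx)

  -- At most one matching edge left free by a forcing set has an end in D,
  -- and W contains the ends of those without.
  forcing-lower-bound : ∀ M (pm : IsPerfectMatching G M) {S} → IsForcingSet G M S →
    (W : List (Fin m)) → (∀ x → D x ≡ false → D (Matching.mate G M pm x) ≡ false → x ∈ W) →
    m ≤ 2 * edgeCount S + length W + 2
  forcing-lower-bound M pm {S} forcing@(S-sym , S⊆M , _) W ∈W = ℕ.≮⇒≥ absurd
    where
    open Matching G M pm
    L : List (Fin m)
    L = support (Covered S) ++ W
    length-L : length L ≡ 2 * edgeCount S + length W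
    length-L = trans (length-++ (support (Covered S)))
      (cong (_+ length W) (trans (sym (countFin≡length (Covered S))) (sym (2*edgeCount S-sym S⊆M))))
    free : ∀ {x} → x ∉ L → Covered S x ≡ false
    free {x} x∉ with Covered S x in eq
    ... | true  = contradiction (∈-++⁺ˡ (∈-support⁺ (Covered S) eq)) x∉
    ... | false = refl
    Covered-mate : ∀ x → Covered S (mate x) ≡ Covered S x
    Covered-mate x = trans (cong (S (mate x)) (mate-involutive x)) (S-sym (mate x) x)
    -- Recording which end of the M-edge at x was taken allows `d≢e` and `d′≢e` to show that two
    -- such ends lie on different M-edges.
    end : ∀ {x} → x ∉ L → ∃ λ d → D d ≡ true × Covered S d ≡ false × (d ≡ x ⊎ d ≡ mate x)
    end {x} x∉ with D x in Dx | D (mate x) in Dx′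
    ... | true  | _     = x , Dx , free x∉ , inj₁ refl
    ... | false | true  = mate x , Dx′ , trans (Covered-mate x) (free x∉) , inj₂ refl
    ... | false | false = contradiction (∈-++⁺ʳ (support (Covered S)) (∈W x Dx Dx′)) x∉
    -- Vertices of D are adjacent to all others, so two free M-edges with ends x and y in D always
    -- close an alternating 4-cycle.
    no-two-ends : ∀ {x y} → x ≢ y → mate x ≢ y → D x ≡ true → D y ≡ true →
      Covered S x ≡ false → Covered S y ≡ false → ⊥
    no-two-ends {x} {y} x≢y x′≢y Dx Dy x-free y-free = no-alternating-4-cycle forcing {x} {y} x≢y x-free y-free
      (joined?⁺ x′≢y (inj₂ (inj₁ Dy))) (joined?⁺ (λ y′≡x → x′≢y (mate-swap y′≡x)) (inj₂ (inj₁ Dx)))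
    no-two-edges : ∀ {x y} → x ∉ L → y ∉ x ∷ mate x ∷ L → ⊥
    no-two-edges {x} {y} x∉ y∉ with end x∉ | end (y∉ ∘ there ∘ there)
    ... | d , Dd , d-free , at-x | e , De , e-free , at-y = no-two-ends (d≢e at-x at-y) (d′≢e at-x at-y) Dd De d-free e-free
      where
      x≢y : x ≢ y
      x≢y x≡y = y∉ (here (sym x≡y))
      x′≢y : mate x ≢ y
      x′≢y x′≡y = y∉ (there (here (sym x′≡y)))
      d≢e : d ≡ x ⊎ d ≡ mate x → e ≡ y ⊎ e ≡ mate y → d ≢ e
      d≢e (inj₁ refl) (inj₁ refl) eq = x≢y eq
      d≢e (inj₁ refl) (inj₂ refl) eq = x′≢y (mate-swap (sym eq))
      d≢e (inj₂ refl) (inj₁ refl) eq = x′≢y eq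
      d≢e (inj₂ refl) (inj₂ refl) eq = x≢y (mate-injective eq)
      d′≢e : d ≡ x ⊎ d ≡ mate x → e ≡ y ⊎ e ≡ mate y → mate d ≢ e
      d′≢e (inj₁ refl) (inj₁ refl) eq = x′≢y eq
      d′≢e (inj₁ refl) (inj₂ refl) eq = x≢y (mate-injective eq)
      d′≢e (inj₂ refl) (inj₁ refl) eq = x≢y (trans (sym (mate-involutive x)) eq)
      d′≢e (inj₂ refl) (inj₂ refl) eq = x′≢y (mate-injective eq)
    absurd : 2 * edgeCount S + length W + 2 < m → ⊥
    absurd small =
      let bound = subst (_< m) (trans (ℕ.+-comm _ 2) (cong (2 +_) (sym length-L))) small
          x , x∉ = ∃-∉ L (ℕ.≤-trans (s≤s (ℕ.m≤n+m (length L) 2)) bound)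
          y , y∉ = ∃-∉ (x ∷ mate x ∷ L) bound
      in  no-two-edges x∉ y∉

  module _ (W : List (Fin m)) (W-unique : Unique W)
    (∈W⁺ : ∀ {x} → D x ≡ false → D (P x) ≡ false → x ∈ W)
    (∈W⁻ : ∀ {x} → x ∈ W → D x ≡ false × D (P x) ≡ false)
    where

    -- Any edge with both ends outside D is a P-edge, so the same `W` serves for every perfect
    -- matching.
    forcing-lower-bound-W : ∀ M → IsPerfectMatching G M → ∀ {S} → IsForcingSet G M S →
      m ≤ 2 * edgeCount S + length W + 2
    forcing-lower-bound-W M pm forcing = forcing-lower-bound M pm forcing W λ x Dx Dx′ →
      ∈W⁺ Dx (trans (cong D (Adj⇒P Dx Dx′ (Matching.Adj-mate G M pm x))) Dx′)

    -- P z is the only vertex of D in W ∪ {z , P z}; it is the only choice for z, after which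
    -- W is matched along its own edges.
    P-forcing-set : ∀ {z} → D z ≡ false → D (P z) ≡ true →
      ∃ λ S → IsForcingSet G P-matching S × 2 * edgeCount S + (2 + length W) ≤ m
    P-forcing-set {z} Dz DPz = forcing-outside G P-matching P-isPerfectMatching
      {z ∷ P z ∷ W} uniq closed agree
      where
      z∉ : z ∉ W
      z∉ z∈ = false≢true (proj₂ (∈W⁻ z∈)) DPz
      Pz∉ : P z ∉ W
      Pz∉ Pz∈ = false≢true (proj₁ (∈W⁻ Pz∈)) DPz
      uniq : Unique (z ∷ P z ∷ W)
      uniq = ((P-≢ z ∘ sym) ∷ All.tabulate (λ x∈ → λ { refl → z∉ x∈ }))
        ∷ All.tabulate (λ x∈ eq → Pz∉ (subst (_∈ W) (sym eq) x∈)) ∷ W-unique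
      closed : ∀ {u} → u ∈ z ∷ P z ∷ W → P u ∈ z ∷ P z ∷ W
      closed (here refl)         = there (here refl)
      closed (there (here refl)) = here (P-involutive z)
      closed (there (there u∈))  = there (there
        (∈W⁺ (proj₂ (∈W⁻ u∈)) (trans (cong D (P-involutive _)) (proj₁ (∈W⁻ u∈)))))
      agree : ∀ {M′} (pm′ : IsPerfectMatching G M′) → let mate′ = Matching.mate G M′ pm′ in
        (∀ {u} → u ∈ z ∷ P z ∷ W → mate′ u ∈ z ∷ P z ∷ W) → ∀ {u} → u ∈ z ∷ P z ∷ W → mate′ u ≡ P u
      agree {M′} pm′ closed′ = λ
        { (here refl)         → at-z
        ; (there (here refl)) → trans (mate-swap at-z) (sym (P-involutive z))
        ; (there (there u∈))  → at-W u∈ }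
        where
        open Matching G M′ pm′
        at-z : mate z ≡ P z
        at-z with closed′ (here refl)
        ... | here eq          = contradiction eq (mate-≢ z)
        ... | there (here eq)  = eq
        ... | there (there z′∈) = sym (Adj⇒P Dz (proj₁ (∈W⁻ z′∈)) (Adj-mate z))
        at-W : ∀ {u} → u ∈ W → mate u ≡ P u
        at-W {u} u∈ with closed′ (there (there u∈))
        ... | here eq          = sym (Adj⇒P (proj₁ (∈W⁻ u∈)) (trans (cong D eq) Dz) (Adj-mate u))
        ... | there (here eq)  = contradiction (subst (_∈ W) (mate-injective (trans eq (sym at-z))) u∈) z∉
        ... | there (there u′∈) = sym (Adj⇒P (proj₁ (∈W⁻ u∈)) (proj₁ (∈W⁻ u′∈)) (Adj-mate u))

-- The construction with parameters t and r

-- A vertex (c , b) lies in the P-pair b; the pairs inj₁ (d , i) lie inside D if d holds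
-- and outside D otherwise, while the pairs inj₂ j have one end in D.
module Blueprint (t r : ℕ) where

  -- The t pairs inside D balance the t pairs outside, so D is half of the vertices; `suc r`
  -- guarantees a pair with one end in D.
  n : ℕ
  n = 2 * t + suc r

  Pair Vertex : Set
  Pair = (Bool × Fin t) ⊎ Fin (suc r)
  Vertex = Bool × Pair

  D₀ : Vertex → Bool
  D₀ (c , inj₁ (d , i)) = d
  D₀ (c , inj₂ j)       = c

  -- Q joins the i-th pair inside D to the i-th pair outside, and agrees with P on the remaining
  -- pairs.
  P₀ Q₀ : Vertex → Vertex
  P₀ (c , b)            = not c , b
  Q₀ (c , inj₁ (d , i)) = c , inj₁ (not d , i)
  Q₀ (c , inj₂ j)       = not c , inj₂ j

  P₀-involutive : ∀ x → P₀ (P₀ x) ≡ x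
  P₀-involutive (c , b) = cong (_, b) (Bool.not-involutive c)

  Q₀-involutive : ∀ x → Q₀ (Q₀ x) ≡ x
  Q₀-involutive (c , inj₁ (d , i)) = cong (λ d → c , inj₁ (d , i)) (Bool.not-involutive d)
  Q₀-involutive (c , inj₂ j)       = cong (_, inj₂ j) (Bool.not-involutive c)

  D₀-Q₀ : ∀ x → D₀ (Q₀ x) ≡ not (D₀ x)
  D₀-Q₀ (c , inj₁ (d , i)) = refl
  D₀-Q₀ (c , inj₂ j)       = refl

  outer : Bool → Fin t → Vertex
  outer c i = c , inj₁ (false , i)

  W₀ : List Vertex
  W₀ = map (outer false) (allFin t) ++ map (outer true) (allFin t)

  length-W₀ : length W₀ ≡ 2 * t
  length-W₀ = begin
    length W₀
      ≡⟨ length-++ (map (outer false) (allFin t)) ⟩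
    length (map (outer false) (allFin t)) + length (map (outer true) (allFin t))
      ≡⟨ cong₂ _+_ (length-outer false) (length-outer true) ⟩
    t + t
      ≡⟨ cong (t +_) (+-identityʳ t) ⟨
    2 * t ∎
    where
    open ≡-Reasoning
    length-outer : ∀ c → length (map (outer c) (allFin t)) ≡ t
    length-outer c = trans (length-map (outer c) (allFin t)) (length-allFin t)

  W₀-unique : Unique W₀
  W₀-unique = Unique.++⁺ (unique false) (unique true) disjoint
    where
    unique : ∀ c → Unique (map (outer c) (allFin t))
    unique c = Unique.map⁺ (λ { refl → refl }) (Unique.allFin⁺ t)
    disjoint : ∀ {x} → ¬ (x ∈ map (outer false) (allFin t) × x ∈ map (outer true) (allFin t))
    disjoint (p , q) with ∈-map⁻ (outer false) p | ∈-map⁻ (outer true) q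
    ... | _ , _ , refl | _ , _ , ()

  ∈W₀⁺ : ∀ x → D₀ x ≡ false → D₀ (P₀ x) ≡ false → x ∈ W₀
  ∈W₀⁺ (false , inj₁ (false , i)) _ _ = ∈-++⁺ˡ (∈-map⁺ (outer false) (∈-allFin i))
  ∈W₀⁺ (true  , inj₁ (false , i)) _ _ = ∈-++⁺ʳ (map (outer false) (allFin t)) (∈-map⁺ (outer true) (∈-allFin i))
  ∈W₀⁺ (false , inj₂ j)           _ ()

  ∈W₀⁻ : ∀ {x} → x ∈ W₀ → D₀ x ≡ false × D₀ (P₀ x) ≡ false
  ∈W₀⁻ x∈ with ∈-++⁻ (map (outer false) (allFin t)) x∈
  ... | inj₁ p with _ , _ , refl ← ∈-map⁻ (outer false) p = refl , refl
  ... | inj₂ q with _ , _ , refl ← ∈-map⁻ (outer true) q = refl , refl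

  -- `2 * (2 * t + suc r)` has the same products and sum as `Vertex`, so the standard bijections on
  -- `Fin` provide the numbering.
  vertices : Fin (2 * n) ↔ Vertex
  vertices = (2↔Bool ×-↔ (((2↔Bool ×-↔ ↔-id _) ↔-∘ *↔×) ⊎-↔ ↔-id _) ↔-∘ +↔⊎) ↔-∘ *↔×

  open Inverse vertices using (to; from; strictlyInverseˡ; strictlyInverseʳ)

  lift : (Vertex → Vertex) → Fin (2 * n) → Fin (2 * n)
  lift f = from ∘ f ∘ to

  lift-involutive : ∀ f → (∀ x → f (f x) ≡ x) → ∀ u → lift f (lift f u) ≡ u
  lift-involutive f inv u = trans (cong from (trans (cong f (strictlyInverseˡ _)) (inv (to u)))) (strictlyInverseʳ u)

  D-lift : ∀ f u → D₀ (to (lift f u)) ≡ D₀ (f (to u))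
  D-lift f u = cong D₀ (strictlyInverseˡ (f (to u)))

  open Construction (D₀ ∘ to) (lift P₀) (lift Q₀)
    (lift-involutive P₀ P₀-involutive)
    (λ u Pu≡u → Bool.not-¬ refl (cong proj₁ (trans (sym (cong to Pu≡u)) (strictlyInverseˡ (P₀ (to u))))))
    (lift-involutive Q₀ Q₀-involutive)
    (λ u → trans (D-lift Q₀ u) (D₀-Q₀ (to u)))
    public

  W : List (Fin (2 * n))
  W = map from W₀

  length-W : length W ≡ 2 * t
  length-W = trans (length-map from W₀) length-W₀

  W-unique : Unique W
  W-unique = Unique.map⁺ (λ {x} {y} eq → trans (sym (strictlyInverseˡ x)) (trans (cong to eq) (strictlyInverseˡ y))) W₀-unique

  ∈W⁺ : ∀ {u} → D₀ (to u) ≡ false → D₀ (to (lift P₀ u)) ≡ false → u ∈ W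
  ∈W⁺ {u} Du DPu = subst (_∈ W) (strictlyInverseʳ u)
    (∈-map⁺ from (∈W₀⁺ (to u) Du (trans (sym (D-lift P₀ u)) DPu)))

  ∈W⁻ : ∀ {u} → u ∈ W → D₀ (to u) ≡ false × D₀ (to (lift P₀ u)) ≡ false
  ∈W⁻ u∈ with x , x∈ , refl ← ∈-map⁻ from u∈ =
    trans (cong D₀ (strictlyInverseˡ x)) (proj₁ (∈W₀⁻ x∈)) ,
    trans (D-lift P₀ (from x)) (trans (cong (D₀ ∘ P₀) (strictlyInverseˡ x)) (proj₂ (∈W₀⁻ x∈)))

  -- The end outside D of a pair having its other end in D, as `P-forcing-set` requires.
  z : Fin (2 * n)
  z = from (false , inj₂ zero)

  -- As `W` has length 2t, this is the point at which the bounds on forcing sets from both sides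
  -- meet at size t + r.
  2*n≡ : 2 * n ≡ 2 * (t + r) + (2 + 2 * t)
  2*n≡ = solve 2 (λ t r → con 2 :* (con 2 :* t :+ (con 1 :+ r)) := con 2 :* (t :+ r) :+ (con 2 :+ con 2 :* t)) refl t r
    where open +-*-Solver

  t+r≤forcing : ∀ M → IsPerfectMatching G M → ∀ S → IsForcingSet G M S → t + r ≤ edgeCount S
  t+r≤forcing M pm S forcing = ℕ.*-cancelˡ-≤ {t + r} {edgeCount S} 2 (ℕ.+-cancelʳ-≤ (2 + 2 * t) _ _ (begin
    2 * (t + r) + (2 + 2 * t)           ≡⟨ 2*n≡ ⟨
    2 * n                               ≤⟨ forcing-lower-bound-W W W-unique ∈W⁺ ∈W⁻ M pm forcing ⟩
    2 * edgeCount S + length W + 2      ≡⟨ cong (λ l → 2 * edgeCount S + l + 2) length-W ⟩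
    2 * edgeCount S + 2 * t + 2         ≡⟨ ℕ.+-assoc (2 * edgeCount S) (2 * t) 2 ⟩
    2 * edgeCount S + (2 * t + 2)       ≡⟨ cong (2 * edgeCount S +_) (ℕ.+-comm (2 * t) 2) ⟩
    2 * edgeCount S + (2 + 2 * t)       ∎))
    where open ℕ.≤-Reasoning

  P-forcing-number : ForcingNumberIs G P-matching (t + r)
  P-forcing-number =
    let S , forcing , le = P-forcing-set W W-unique ∈W⁺ ∈W⁻ {z} Dz DPz
        lower = t+r≤forcing P-matching P-isPerfectMatching
        upper = ℕ.*-cancelˡ-≤ {edgeCount S} {t + r} 2 (ℕ.+-cancelʳ-≤ (2 + 2 * t) _ _
          (subst₂ _≤_ (cong (λ l → 2 * edgeCount S + (2 + l)) length-W) 2*n≡ le))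
    in  (S , forcing , ≤-antisym upper (lower S forcing)) , lower
    where
    Dz : D₀ (to z) ≡ false
    Dz = cong D₀ (strictlyInverseˡ (false , inj₂ zero))
    DPz : D₀ (to (lift P₀ z)) ≡ true
    DPz = trans (D-lift P₀ z) (cong (D₀ ∘ P₀) (strictlyInverseˡ (false , inj₂ zero)))

  minForcingNumber : MinForcingNumberIs G (t + r)
  minForcingNumber = (P-matching , P-isPerfectMatching , P-forcing-number)
    , λ { M _ pm ((S , forcing , refl) , _) → t+r≤forcing M pm S forcing }

  -- No Q-edge has both ends outside D, so the general bound applies with the empty list.
  Q-forcing-lower-bound : ∀ S → IsForcingSet G Q-matching S → n ∸ 1 ≤ edgeCount S
  Q-forcing-lower-bound S forcing = ℕ.m≤n+o⇒m∸n≤o n 1 (ℕ.*-cancelˡ-≤ {n} {suc (edgeCount S)} 2 (begin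
    2 * n                   ≤⟨ forcing-lower-bound Q-matching Q-isPerfectMatching forcing [] Q-ends ⟩
    2 * edgeCount S + 0 + 2 ≡⟨ cong (_+ 2) (+-identityʳ (2 * edgeCount S)) ⟩
    2 * edgeCount S + 2     ≡⟨ ℕ.+-comm (2 * edgeCount S) 2 ⟩
    2 + 2 * edgeCount S     ≡⟨ ℕ.*-suc 2 (edgeCount S) ⟨
    2 * suc (edgeCount S)   ∎))
    where
    open ℕ.≤-Reasoning
    Q-ends : ∀ u → D₀ (to u) ≡ false → D₀ (to (lift Q₀ u)) ≡ false → u ∈ []
    Q-ends u Du DQu = contradiction (trans (sym (cong not Du)) (trans (sym (trans (D-lift Q₀ u) (D₀-Q₀ (to u)))) DQu)) λ ()

  maxForcingNumber : MaxForcingNumberIs G (n ∸ 1)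
  maxForcingNumber =
    let S , forcing , upper = forcing-n∸1 {n} 1≤n G Q-matching Q-isPerfectMatching
    in  (Q-matching , Q-isPerfectMatching
          , (S , forcing , ≤-antisym upper (Q-forcing-lower-bound S forcing)) , Q-forcing-lower-bound)
        , λ M j pm → forcing-number≤n∸1 {n} 1≤n G M pm
    where
    1≤n : 1 ≤ n
    1≤n = ℕ.≤-trans (s≤s z≤n) (ℕ.m≤n+m (suc r) (2 * t))

-- The full interval of values

Realisable : ℕ → ℕ → Set
Realisable n k = Σ (Graph (2 * n)) λ G →
  HasPerfectMatching G × MaxForcingNumberIs G (n ∸ 1) × MinForcingNumberIs G k

realise : ∀ t r → Realisable (2 * t + suc r) (t + r)
realise t r = G , (P-matching , P-isPerfectMatching) , maxForcingNumber , minForcingNumber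
  where open Blueprint t r

-- The equations t + r = k and 2t + r = n give t = n - k and r = k - t; the lower bound on k ensures
-- t ≤ k, so that no subtraction truncates.
realise-interval : ∀ n k → ⌊ suc n /2⌋ ≤ k → k ≤ n → Realisable (suc n) k
realise-interval n k half≤k k≤n = subst₂ Realisable n-eq k-eq (realise t r)
  where
  t r : ℕ
  t = n ∸ k
  r = k ∸ t
  t≤k : t ≤ k
  t≤k = begin
    n ∸ k                         ≤⟨ ℕ.∸-monoʳ-≤ n half≤k ⟩
    -- `⌈ n /2⌉` unfolds to `⌊ suc n /2⌋`, the lower bound on k.
    n ∸ ⌈ n /2⌉                   ≡⟨ cong (_∸ ⌈ n /2⌉) (ℕ.⌊n/2⌋+⌈n/2⌉≡n n) ⟨
    ⌊ n /2⌋ + ⌈ n /2⌉ ∸ ⌈ n /2⌉   ≡⟨ ℕ.m+n∸n≡m ⌊ n /2⌋ ⌈ n /2⌉ ⟩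
    ⌊ n /2⌋                       ≤⟨ ℕ.⌊n/2⌋-mono (ℕ.n≤1+n n) ⟩
    ⌊ suc n /2⌋                   ≤⟨ half≤k ⟩
    k                             ∎
    where open ℕ.≤-Reasoning
  k-eq : t + r ≡ k
  k-eq = ℕ.m+[n∸m]≡n t≤k
  n-eq : 2 * t + suc r ≡ suc n
  n-eq = begin
    2 * t + suc r   ≡⟨ solve 2 (λ t r → con 2 :* t :+ (con 1 :+ r) := con 1 :+ (t :+ (t :+ r))) refl t r ⟩
    suc (t + (t + r)) ≡⟨ cong (λ x → suc (t + x)) k-eq ⟩
    suc (t + k)     ≡⟨ cong suc (ℕ.m∸n+n≡m k≤n) ⟩
    suc n           ∎
    where
    open ≡-Reasoning
    open +-*-Solver

theorem5p7 : ∀ (n : ℕ) → 1 ≤ n → ∀ (k : ℕ) →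
    (Σ (Graph (2 * n)) λ G →
    HasPerfectMatching G × MaxForcingNumberIs G (n ∸ 1) × MinForcingNumberIs G k)
    ⇔ (⌊ n /2⌋ ≤ k × k ≤ n ∸ 1)
theorem5p7 n@(suc n′) 1≤n k = mk⇔ necessary λ (half≤k , k≤n′) → realise-interval n′ k half≤k k≤n′
  where
  -- The minimum is attained at some M, so k is the size of a forcing set of M. The matching M₀
  -- attaining the maximum bounds it from below, and the general bound for M from above.
  necessary : Realisable n k → ⌊ n /2⌋ ≤ k × k ≤ n ∸ 1
  necessary (G , _ , ((M₀ , pm₀ , extremal) , _) , ((M , pm , f@((S , forcing , S≡k) , _)) , _)) =
      subst (⌊ n /2⌋ ≤_) S≡k (⌊n/2⌋≤forcing {n} G M₀ M pm₀ extremal pm S forcing)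
    , forcing-number≤n∸1 {n} 1≤n G M pm f
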